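{- Let $P \subseteq \mathbb{R}^d$ be a rational polytope (of any dimension). Then there exists an integer vector $w \in \mathbb{Z}^d$ such that the functions $s \mapsto L_{P + kw}(s)$, for integers $k \geq 0$, are pairwise distinct.
   Context: For a polytope $P \subseteq \mathbb{R}^d$ and real $s \ge 0$, the real Ehrhart function is $L_P(s) = \#(sP \cap \mathbb{Z}^d)$, where $sP = \{sx : x \in P\}$. A rational polytope is the convex hull of finitely many points of $\mathbb{Q}^d$.
   Formalization: The polytope P is assumed nonempty and d ≥ 1; for P empty all the functions vanish, and for d = 0 all translates coincide, so the claim fails in those cases. -}

module Defs where

open import Data.Nat.Base as ℕ using (ℕ)
import Data.Nat.Properties as ℕ
open import Data.Integer.Base as ℤ using (ℤ)
open import Data.Rational.Base as ℚ using (ℚ; 0ℚ; 1ℚ; ½; ∣_∣; 1/_; positive; NonZero)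
import Data.Rational.Properties as ℚ
open import Data.Rational.Solver using (module +-*-Solver)
open import Data.Fin.Base using (Fin)
open import Data.List.Base using (List; length)
open import Data.List.Membership.Propositional using () renaming (_∈_ to _∈ˡ_)
open import Data.List.Relation.Unary.Unique.Propositional using (Unique)
open import Data.List.Relation.Binary.BagAndSetEquality using (∼bag⇒↭)
open import Data.List.Membership.Propositional.Properties.WithK using (unique∧set⇒bag)
open import Data.List.Relation.Binary.Permutation.Propositional.Properties using (↭-length)
open import Data.Product.Base using (∃; ∃-syntax; _×_; _,_)
open import Data.Vec.Base as Vec using (Vec)
open import Data.Vec.Functional using (Vector; foldr)
open import Function.Bundles using (_⇔_)
open import Function.Properties.Equivalence using (⇔-isEquivalence)
open import Level using (0ℓ)
open import Relation.Binary.PropositionalEquality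
  using (_≡_; refl; sym; trans; cong; cong₂; subst; subst₂)
open import Relation.Binary.Structures using (IsEquivalence)
open import Relation.Unary using (Pred; _∈_; _≐_)

private
  module ⇔ {ℓ} = IsEquivalence (⇔-isEquivalence {ℓ = ℓ})
  variable
    d n : ℕ

------------------------------------------------------------------------
-- Real numbers as Cauchy sequences of rationals, up to _≈_

Cauchy : (ℕ → ℚ) → Set
Cauchy x = ∀ ε → 0ℚ ℚ.< ε →
  ∃[ N ] ∀ m n → N ℕ.≤ m → N ℕ.≤ n → ∣ x m ℚ.- x n ∣ ℚ.< ε

record ℝ : Set where
  constructor mkℝ
  field
    seq    : ℕ → ℚ
    cauchy : Cauchy seq

open ℝ public

infix 4 _≈_ _≤_

_≈_ : ℝ → ℝ → Set
x ≈ y = ∀ ε → 0ℚ ℚ.< ε →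
  ∃[ N ] ∀ n → N ℕ.≤ n → ∣ seq x n ℚ.- seq y n ∣ ℚ.< ε

_≤_ : ℝ → ℝ → Set
x ≤ y = ∀ ε → 0ℚ ℚ.< ε →
  ∃[ N ] ∀ n → N ℕ.≤ n → seq x n ℚ.< seq y n ℚ.+ ε

private abstract
  half-pos : ∀ {ε} → 0ℚ ℚ.< ε → 0ℚ ℚ.< ½ ℚ.* ε
  half-pos {ε} 0<ε = subst (ℚ._< ½ ℚ.* ε) (ℚ.*-zeroʳ ½) (ℚ.*-monoʳ-<-pos ½ 0<ε)

  half+half : ∀ ε → ½ ℚ.* ε ℚ.+ ½ ℚ.* ε ≡ ε
  half+half ε = trans (sym (ℚ.*-distribʳ-+ ε ½ ½)) (ℚ.*-identityˡ ε)

  ⊔ˡ : ∀ M N {n} → M ℕ.⊔ N ℕ.≤ n → M ℕ.≤ n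
  ⊔ˡ M N = ℕ.≤-trans (ℕ.m≤m⊔n M N)

  ⊔ʳ : ∀ M N {n} → M ℕ.⊔ N ℕ.≤ n → N ℕ.≤ n
  ⊔ʳ M N = ℕ.≤-trans (ℕ.m≤n⊔m M N)

  cauchy-const : ∀ q → Cauchy (λ _ → q)
  cauchy-const q ε 0<ε = 0 , λ _ _ _ _ →
    subst (ℚ._< ε) (sym (cong ∣_∣ (ℚ.+-inverseʳ q))) 0<ε

  cauchy-+ : ∀ {x y} → Cauchy x → Cauchy y → Cauchy (λ n → x n ℚ.+ y n)
  cauchy-+ {x} {y} cx cy ε 0<ε
    with M , p ← cx (½ ℚ.* ε) (half-pos 0<ε)
       | N , q ← cy (½ ℚ.* ε) (half-pos 0<ε)
    = M ℕ.⊔ N , λ m n m≥ n≥ → begin-strict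
        ∣ (x m ℚ.+ y m) ℚ.- (x n ℚ.+ y n) ∣
          ≡⟨ cong ∣_∣ (rearrange (x m) (y m) (x n) (y n)) ⟩
        ∣ (x m ℚ.- x n) ℚ.+ (y m ℚ.- y n) ∣
          ≤⟨ ℚ.∣p+q∣≤∣p∣+∣q∣ (x m ℚ.- x n) (y m ℚ.- y n) ⟩
        ∣ x m ℚ.- x n ∣ ℚ.+ ∣ y m ℚ.- y n ∣
          <⟨ ℚ.+-mono-< (p m n (⊔ˡ M N m≥) (⊔ˡ M N n≥)) (q m n (⊔ʳ M N m≥) (⊔ʳ M N n≥)) ⟩
        ½ ℚ.* ε ℚ.+ ½ ℚ.* ε
          ≡⟨ half+half ε ⟩
        ε ∎
    where
    open ℚ.≤-Reasoning
    rearrange : ∀ a b c e → (a ℚ.+ b) ℚ.- (c ℚ.+ e) ≡ (a ℚ.- c) ℚ.+ (b ℚ.- e)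
    rearrange = solve 4 (λ a b c e → (a :+ b) :- (c :+ e) := (a :- c) :+ (b :- e)) refl
      where open +-*-Solver

  eventually-bounded : ∀ {x} → Cauchy x →
    ∃[ B ] 0ℚ ℚ.< B × ∃[ N ] ∀ n → N ℕ.≤ n → ∣ x n ∣ ℚ.≤ B
  eventually-bounded {x} cx with N , p ← cx 1ℚ (ℚ.positive⁻¹ 1ℚ)
    = 1ℚ ℚ.+ ∣ x N ∣
    , ℚ.+-mono-<-≤ (ℚ.positive⁻¹ 1ℚ) (ℚ.0≤∣p∣ (x N))
    , N , λ n n≥ → begin
        ∣ x n ∣                         ≡⟨ cong ∣_∣ (split (x n) (x N)) ⟩
        ∣ (x n ℚ.- x N) ℚ.+ x N ∣       ≤⟨ ℚ.∣p+q∣≤∣p∣+∣q∣ (x n ℚ.- x N) (x N) ⟩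
        ∣ x n ℚ.- x N ∣ ℚ.+ ∣ x N ∣     ≤⟨ ℚ.+-monoˡ-≤ ∣ x N ∣ (ℚ.<⇒≤ (p n N n≥ ℕ.≤-refl)) ⟩
        1ℚ ℚ.+ ∣ x N ∣                  ∎
    where
    open ℚ.≤-Reasoning
    split : ∀ a b → a ≡ (a ℚ.- b) ℚ.+ b
    split = solve 2 (λ a b → a := (a :- b) :+ b) refl
      where open +-*-Solver

  cauchy-scale : ∀ {x} B → 0ℚ ℚ.< B → Cauchy x → ∀ ε → 0ℚ ℚ.< ε →
    ∃[ N ] ∀ m n → N ℕ.≤ m → N ℕ.≤ n → B ℚ.* ∣ x m ℚ.- x n ∣ ℚ.< ε
  cauchy-scale {x} B 0<B cx ε 0<ε =
    let N , p = cx (1/ B ℚ.* ε) 0<δ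
    in N , λ m n m≥ n≥ →
      subst (B ℚ.* ∣ x m ℚ.- x n ∣ ℚ.<_) cancel (ℚ.*-monoʳ-<-pos B (p m n m≥ n≥))
    where
    instance
      B-pos : ℚ.Positive B
      B-pos = positive 0<B
      B-nonZero : NonZero B
      B-nonZero = ℚ.pos⇒nonZero B
      1/B-pos : ℚ.Positive (1/ B)
      1/B-pos = ℚ.1/pos⇒pos B
    0<δ : 0ℚ ℚ.< 1/ B ℚ.* ε
    0<δ = subst (ℚ._< 1/ B ℚ.* ε) (ℚ.*-zeroʳ (1/ B)) (ℚ.*-monoʳ-<-pos (1/ B) 0<ε)
    cancel : B ℚ.* (1/ B ℚ.* ε) ≡ ε
    cancel = trans (sym (ℚ.*-assoc B (1/ B) ε))
      (trans (cong (ℚ._* ε) (ℚ.*-inverseʳ B)) (ℚ.*-identityˡ ε))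

  ∣*-*∣< : ∀ a b c e A B ε → ∣ a ∣ ℚ.≤ A → ∣ e ∣ ℚ.≤ B →
    B ℚ.* ∣ a ℚ.- c ∣ ℚ.< ½ ℚ.* ε → A ℚ.* ∣ b ℚ.- e ∣ ℚ.< ½ ℚ.* ε →
    ∣ a ℚ.* b ℚ.- c ℚ.* e ∣ ℚ.< ε
  ∣*-*∣< a b c e A B ε a≤A e≤B p q = begin-strict
    ∣ a ℚ.* b ℚ.- c ℚ.* e ∣
      ≡⟨ cong ∣_∣ (rearrange a b c e) ⟩
    ∣ e ℚ.* (a ℚ.- c) ℚ.+ a ℚ.* (b ℚ.- e) ∣
      ≤⟨ ℚ.∣p+q∣≤∣p∣+∣q∣ (e ℚ.* (a ℚ.- c)) (a ℚ.* (b ℚ.- e)) ⟩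
    ∣ e ℚ.* (a ℚ.- c) ∣ ℚ.+ ∣ a ℚ.* (b ℚ.- e) ∣
      ≤⟨ ℚ.+-mono-≤ (bound e B (a ℚ.- c) e≤B) (bound a A (b ℚ.- e) a≤A) ⟩
    B ℚ.* ∣ a ℚ.- c ∣ ℚ.+ A ℚ.* ∣ b ℚ.- e ∣
      <⟨ ℚ.+-mono-< p q ⟩
    ½ ℚ.* ε ℚ.+ ½ ℚ.* ε
      ≡⟨ half+half ε ⟩
    ε ∎
    where
    open ℚ.≤-Reasoning
    rearrange : ∀ a b c e → a ℚ.* b ℚ.- c ℚ.* e ≡ e ℚ.* (a ℚ.- c) ℚ.+ a ℚ.* (b ℚ.- e)
    rearrange = solve 4 (λ a b c e → a :* b :- c :* e := e :* (a :- c) :+ a :* (b :- e)) refl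
      where open +-*-Solver
    bound : ∀ r C t → ∣ r ∣ ℚ.≤ C → ∣ r ℚ.* t ∣ ℚ.≤ C ℚ.* ∣ t ∣
    bound r C t r≤C = subst (ℚ._≤ C ℚ.* ∣ t ∣) (sym (ℚ.∣p*q∣≡∣p∣*∣q∣ r t))
      (ℚ.*-monoʳ-≤-nonNeg ∣ t ∣ {{ℚ.nonNegative (ℚ.0≤∣p∣ t)}} r≤C)

  cauchy-* : ∀ {x y} → Cauchy x → Cauchy y → Cauchy (λ n → x n ℚ.* y n)
  cauchy-* {x} {y} cx cy ε 0<ε =
    let A , 0<A , K , a = eventually-bounded cx
        B , 0<B , L , b = eventually-bounded cy
        M , p = cauchy-scale {x} B 0<B cx (½ ℚ.* ε) (half-pos 0<ε)
        N , q = cauchy-scale {y} A 0<A cy (½ ℚ.* ε) (half-pos 0<ε)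
    in (K ℕ.⊔ L) ℕ.⊔ (M ℕ.⊔ N) , λ m n m≥ n≥ →
      let m≥KL = ⊔ˡ (K ℕ.⊔ L) (M ℕ.⊔ N) m≥
          n≥KL = ⊔ˡ (K ℕ.⊔ L) (M ℕ.⊔ N) n≥
          m≥MN = ⊔ʳ (K ℕ.⊔ L) (M ℕ.⊔ N) m≥
          n≥MN = ⊔ʳ (K ℕ.⊔ L) (M ℕ.⊔ N) n≥
      in ∣*-*∣< (x m) (y m) (x n) (y n) A B ε
           (a m (⊔ˡ K L m≥KL)) (b n (⊔ʳ K L n≥KL))
           (p m n (⊔ˡ M N m≥MN) (⊔ˡ M N n≥MN))
           (q m n (⊔ʳ M N m≥MN) (⊔ʳ M N n≥MN))

fromℚ : ℚ → ℝ
fromℚ q = mkℝ (λ _ → q) (cauchy-const q)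

fromℤ : ℤ → ℝ
fromℤ z = fromℚ (z ℚ./ 1)

0ℝ 1ℝ : ℝ
0ℝ = fromℚ 0ℚ
1ℝ = fromℚ 1ℚ

infixl 6 _+_
infixl 7 _*_

_+_ : ℝ → ℝ → ℝ
x + y = mkℝ (λ n → seq x n ℚ.+ seq y n) (cauchy-+ {seq x} {seq y} (cauchy x) (cauchy y))

_*_ : ℝ → ℝ → ℝ
x * y = mkℝ (λ n → seq x n ℚ.* seq y n) (cauchy-* {seq x} {seq y} (cauchy x) (cauchy y))

sum : Vector ℝ n → ℝ
sum = foldr _+_ 0ℝ

------------------------------------------------------------------------
-- Subsets of ℝᵈ

infix 4 _≈ᵛ_

_≈ᵛ_ : Vector ℝ d → Vector ℝ d → Set
x ≈ᵛ y = ∀ i → x i ≈ y i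

Subset : ℕ → Set₁
Subset d = Pred (Vector ℝ d) 0ℓ

embed : Vec ℤ d → Vector ℝ d
embed z i = fromℤ (Vec.lookup z i)

infixr 7 _•_ _·_
infixl 6 _+ᵗ_

_•_ : ℕ → Vec ℤ d → Vec ℤ d
k • w = Vec.map (ℤ.+ k ℤ.*_) w

_·_ : ℝ → Subset d → Subset d
(s · P) y = ∃[ x ] x ∈ P × y ≈ᵛ (λ i → s * x i)

_+ᵗ_ : Subset d → Vec ℤ d → Subset d
(P +ᵗ w) y = ∃[ x ] x ∈ P × y ≈ᵛ (λ i → x i + embed w i)

convexHull : Vector (Vector ℚ d) n → Subset d
convexHull {n = n} v y = ∃ λ (c : Vector ℝ n) →
  (∀ j → 0ℝ ≤ c j) × sum c ≈ 1ℝ × y ≈ᵛ (λ i → sum (λ j → c j * fromℚ (v j i)))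

-- The family of points may be empty, so the empty set is included here.
IsRationalPolytope : Subset d → Set
IsRationalPolytope {d} P = ∃[ n ] ∃ λ (v : Vector (Vector ℚ d) n) → P ≐ convexHull v

------------------------------------------------------------------------
-- The real Ehrhart function

HasCardinality : Pred (Vec ℤ d) 0ℓ → ℕ → Set
HasCardinality A n = ∃[ zs ] Unique zs × (∀ {z} → z ∈ˡ zs ⇔ z ∈ A) × length zs ≡ n

-- L P s n means L_P(s) = n. Membership of a lattice point in s · P is not
-- decidable for real s, so the counting function is given by its graph.
L : Subset d → ℝ → ℕ → Set
L P s = HasCardinality (λ z → embed z ∈ s · P)

L-functional : ∀ {P : Subset d} {s m n} → L P s m → L P s n → m ≡ n
L-functional (xs , ux , ex , refl) (ys , uy , ey , refl) =
  ↭-length (∼bag⇒↭ (unique∧set⇒bag ux uy (⇔.trans ex (⇔.sym ey))))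

-- Equality of the functions L_P and L_Q on the domain s ≥ 0.
SameEhrhart : Subset d → Subset d → Set
SameEhrhart P Q = ∀ s → 0ℝ ≤ s → ∀ n → L P s n ⇔ L Q s n

{-# OPTIONS --safe #-}

-- Let p = c b be a vertex of P with b a primitive integer vector, let u be an
-- integer functional with u(b) = 1, and take w = M b with M large. Dilated by
-- σ = 1/(kM + c), the translate P + kw contains b, the image of p + kw, whereas
-- for 0 < j < k the dilate of P + jw lies in the slab 0 < u < 1 and has no
-- lattice points. For j = 0, M is so large that σP has no lattice point other
-- than possibly the origin. If σP contains the origin then so does (σ/2)P,
-- while (σ/2)(P + kw) again lies in the open slab.

module Submission where

open import Defs
open import Algebra.Bundles using (CommutativeRing)
import Algebra.Properties.Semiring.Sum as SemiringSum
open import Data.Fin.Base using (Fin; zero; suc)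
open import Data.Integer.Base as ℤ using (ℤ; +_; -[1+_]; 0ℤ; 1ℤ)
import Data.Integer.Properties as ℤ
import Data.Integer.Solver as ℤ
open import Data.List.Base using ([])
open import Data.List.Relation.Unary.AllPairs.Core using ([])
open import Data.Nat.Base as ℕ using (ℕ; NonZero; zero; suc)
open import Data.Nat.Divisibility using (divides)
open import Data.Nat.GCD using (module Bézout; module GCD)
import Data.Nat.Coprimality as Coprimality
import Data.Nat.Properties as ℕ
open import Data.Product.Base using (∃; ∃-syntax; _×_; _,_)
open import Data.Rational.Base as ℚ using (ℚ; mkℚ; 0ℚ; 1ℚ; ½; ∣_∣; 1/_; ↥_; ↧_)
import Data.Rational.Properties as ℚ
import Data.Rational.Solver as ℚ
import Data.Rational.Unnormalised.Base as ℚᵘ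
open import Data.Sum.Base using (inj₁; inj₂)
open import Data.Vec.Base as Vec using (Vec)
import Data.Vec.Properties as Vec
open import Data.Vec.Functional using (Vector; head; tail) renaming (_∷_ to _◂_)
open import Function.Base using (_∘_)
open import Function.Bundles using (Equivalence; mk⇔)
open import Relation.Binary.Definitions using (tri<; tri≈; tri>)
open import Relation.Binary.PropositionalEquality
  using (_≡_; _≢_; refl; sym; trans; cong; cong₂; subst; subst₂; module ≡-Reasoning)
open import Relation.Nullary.Negation using (¬_; contradiction)
open import Relation.Unary using (Satisfiable; _∈_; _∉_)

private
  module ℚΣ = SemiringSum (CommutativeRing.semiring ℚ.+-*-commutativeRing)
  module ℤΣ = SemiringSum (CommutativeRing.semiring ℤ.+-*-commutativeRing)

-- Inequalities between rationals

-- Reduces a linear rearrangement of a strict inequality to an identity between the two differences,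
-- which the ring solver can prove.
<-from-gap : ∀ {a b p q} → a ℚ.< b → b ℚ.- a ≡ q ℚ.- p → p ℚ.< q
<-from-gap {a} {b} {p} {q} a<b eq = subst₂ ℚ._<_ (left a p) right (ℚ.+-monoˡ-< (p ℚ.- a) a<b)
  where
  open ℚ.+-*-Solver
  left : ∀ a p → a ℚ.+ (p ℚ.- a) ≡ p
  left = solve 2 (λ a p → a :+ (p :- a) := p) refl
  swap : ∀ a b p → b ℚ.+ (p ℚ.- a) ≡ p ℚ.+ (b ℚ.- a)
  swap = solve 3 (λ a b p → b :+ (p :- a) := p :+ (b :- a)) refl
  back : ∀ p q → p ℚ.+ (q ℚ.- p) ≡ q
  back = solve 2 (λ p q → p :+ (q :- p) := q) refl
  right : b ℚ.+ (p ℚ.- a) ≡ q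
  right = trans (swap a b p) (trans (cong (p ℚ.+_) eq) (back p q))

p≤∣p∣ : ∀ p → p ℚ.≤ ∣ p ∣
p≤∣p∣ p with ℚ.≤-total 0ℚ p
... | inj₁ 0≤p = ℚ.≤-reflexive (sym (ℚ.0≤p⇒∣p∣≡p 0≤p))
... | inj₂ p≤0 = ℚ.≤-trans p≤0 (ℚ.0≤∣p∣ p)

-p≤∣p∣ : ∀ p → ℚ.- p ℚ.≤ ∣ p ∣
-p≤∣p∣ p = subst (ℚ.- p ℚ.≤_) (ℚ.∣-p∣≡∣p∣ p) (p≤∣p∣ (ℚ.- p))

*-pos : ∀ {p q} → 0ℚ ℚ.< p → 0ℚ ℚ.< q → 0ℚ ℚ.< p ℚ.* q
*-pos {p} {q} 0<p 0<q =
  subst (ℚ._< p ℚ.* q) (ℚ.*-zeroʳ p) (ℚ.*-monoʳ-<-pos p {{ℚ.positive 0<p}} 0<q)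

inverse : ∀ {p} → 0ℚ ℚ.< p → ∃ λ r → 0ℚ ℚ.< r × p ℚ.* r ≡ 1ℚ
inverse {p} 0<p = 1/ p , ℚ.positive⁻¹ (1/ p) {{ℚ.1/pos⇒pos p}} , ℚ.*-inverseʳ p
  where
  instance
    p-pos : ℚ.Positive p
    p-pos = ℚ.positive 0<p
    p-nonZero : ℚ.NonZero p
    p-nonZero = ℚ.pos⇒nonZero p

∣sum∣≤sum : ∀ {n} (f g : Vector ℚ n) → (∀ i → ∣ f i ∣ ℚ.≤ g i) → ∣ ℚΣ.sum f ∣ ℚ.≤ ℚΣ.sum g
∣sum∣≤sum {zero}  f g f≤g = ℚ.≤-refl
∣sum∣≤sum {suc n} f g f≤g = ℚ.≤-trans (ℚ.∣p+q∣≤∣p∣+∣q∣ (head f) (ℚΣ.sum (tail f)))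
  (ℚ.+-mono-≤ (f≤g zero) (∣sum∣≤sum (tail f) (tail g) (f≤g ∘ suc)))

sum-nonNeg : ∀ {n} (f : Vector ℚ n) → (∀ i → 0ℚ ℚ.≤ f i) → 0ℚ ℚ.≤ ℚΣ.sum f
sum-nonNeg {zero}  f 0≤f = ℚ.≤-refl
sum-nonNeg {suc n} f 0≤f = ℚ.+-mono-≤ (0≤f zero) (sum-nonNeg (tail f) (0≤f ∘ suc))

term≤sum : ∀ {n} (f : Vector ℚ n) → (∀ i → 0ℚ ℚ.≤ f i) → ∀ i → f i ℚ.≤ ℚΣ.sum f
term≤sum f 0≤f zero = subst (ℚ._≤ ℚΣ.sum f) (ℚ.+-identityʳ (f zero))
  (ℚ.+-monoʳ-≤ (f zero) (sum-nonNeg (tail f) (0≤f ∘ suc)))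
term≤sum f 0≤f (suc i) = subst (ℚ._≤ ℚΣ.sum f) (ℚ.+-identityˡ (f (suc i)))
  (ℚ.+-mono-≤ (0≤f zero) (term≤sum (tail f) (0≤f ∘ suc) i))

-- The embedding of the integers into the rationals

ι : ℤ → ℚ
ι z = z ℚ./ 1

-- The normal form of ι z, in which the operations of ℚ compute.
reduced : ℤ → ℚ
reduced z = mkℚ z 0 (Coprimality.sym (Coprimality.1-coprimeTo ℤ.∣ z ∣))

ι≡reduced : ∀ z → ι z ≡ reduced z
ι≡reduced z = ℚ.↥p/↧p≡p (reduced z)

ι-+ : ∀ x y → ι (x ℤ.+ y) ≡ ι x ℚ.+ ι y
ι-+ x y rewrite ι≡reduced x | ι≡reduced y =
  cong ι (sym (cong₂ ℤ._+_ (ℤ.*-identityʳ x) (ℤ.*-identityʳ y)))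

ι-* : ∀ x y → ι (x ℤ.* y) ≡ ι x ℚ.* ι y
ι-* x y rewrite ι≡reduced x | ι≡reduced y = refl

ι-mono-≤ : ∀ {x y} → x ℤ.≤ y → ι x ℚ.≤ ι y
ι-mono-≤ {x} {y} x≤y rewrite ι≡reduced x | ι≡reduced y =
  ℚ.*≤* (subst₂ ℤ._≤_ (sym (ℤ.*-identityʳ x)) (sym (ℤ.*-identityʳ y)) x≤y)

ι-cancel-< : ∀ {x y} → ι x ℚ.< ι y → x ℤ.< y
ι-cancel-< {x} {y} x<y = ℤ.≰⇒> λ y≤x → ℚ.<-irrefl refl (ℚ.<-≤-trans x<y (ι-mono-≤ y≤x))

p*↧p≡↥p : ∀ p → p ℚ.* ι (↧ p) ≡ ι (↥ p)
p*↧p≡↥p p@record{} rewrite ι≡reduced (↧ p) =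
  ℚ.fromℚᵘ-cong {ℚᵘ.mkℚᵘ (↥ p ℤ.* ↧ p) _} {ℚᵘ.mkℚᵘ (↥ p) 0}
    (ℚᵘ.*≡* (trans (ℤ.*-identityʳ _) (cong (λ e → ↥ p ℤ.* + e) (sym (ℕ.*-identityʳ (ℚ.↧ₙ p))))))

archimedean : ∀ q → ∃ λ (n : ℕ) → q ℚ.< ι (+ n)
archimedean q@record{} = suc m , subst (q ℚ.<_) (sym (ι≡reduced (+ suc m))) (ℚ.*<* (begin-strict
  ↥ q ℤ.* 1ℤ      ≡⟨ ℤ.*-identityʳ (↥ q) ⟩
  ↥ q             ≤⟨ i≤∣i∣ (↥ q) ⟩
  + m             <⟨ ℤ.+<+ (ℕ.n<1+n m) ⟩
  + suc m         ≤⟨ ℤ.+≤+ (ℕ.m≤m*n (suc m) (ℚ.↧ₙ q)) ⟩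
  + (suc m ℕ.* ℚ.↧ₙ q) ≡⟨ ℤ.pos-* (suc m) (ℚ.↧ₙ q) ⟩
  + suc m ℤ.* ↧ q ∎))
  where
  open ℤ.≤-Reasoning
  m = ℤ.∣ ↥ q ∣
  i≤∣i∣ : ∀ i → i ℤ.≤ + ℤ.∣ i ∣
  i≤∣i∣ (+ n)    = ℤ.≤-refl
  i≤∣i∣ -[1+ n ] = ℤ.-≤+

-- The sum of the absolute values dominates every entry, so a single natural number exceeds them
-- all. Later it meets all requirements on the size of `M` at once.
archimedean-all : ∀ {n} (q : Vector ℚ n) → ∃ λ (M : ℕ) → ∀ i → q i ℚ.< ι (+ M)
archimedean-all q =
  let M , Σ<M = archimedean (ℚΣ.sum (∣_∣ ∘ q)) in
  M , λ i → ℚ.≤-<-trans (p≤∣p∣ (q i)) (ℚ.≤-<-trans (term≤sum (∣_∣ ∘ q) (λ i → ℚ.0≤∣p∣ (q i)) i) Σ<M)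

-- Primitive vectors

dot : ∀ {n} → Vector ℤ n → Vector ℤ n → ℤ
dot u z = ℤΣ.sum λ i → u i ℤ.* z i

dot-*ʳ : ∀ {n} a (u z : Vector ℤ n) → dot u (λ i → a ℤ.* z i) ≡ a ℤ.* dot u z
dot-*ʳ a u z = sym (trans (ℤΣ.*-distribˡ-sum a (λ i → u i ℤ.* z i))
  (ℤΣ.sum-cong-≗ λ i → rearrange a (u i) (z i)))
  where
  rearrange : ∀ a u z → a ℤ.* (u ℤ.* z) ≡ u ℤ.* (a ℤ.* z)
  rearrange = solve 3 (λ a u z → a :* (u :* z) := u :* (a :* z)) refl
    where open ℤ.+-*-Solver

dot-*ˡ : ∀ {n} a (u z : Vector ℤ n) → dot (λ i → a ℤ.* u i) z ≡ a ℤ.* dot u z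
dot-*ˡ a u z = sym (trans (ℤΣ.*-distribˡ-sum a (λ i → u i ℤ.* z i))
  (ℤΣ.sum-cong-≗ λ i → sym (ℤ.*-assoc a (u i) (z i))))

-- The sign `e` comes with `e * e ≡ 1ℤ` rather than as a case distinction, so that it cancels when
-- it is put on both a vector and its dual functional.
sign-decomposition : ∀ x → ∃ λ e → e ℤ.* e ≡ 1ℤ × x ≡ e ℤ.* + ℤ.∣ x ∣
sign-decomposition (+ n)    = 1ℤ , refl , sym (ℤ.*-identityˡ (+ n))
sign-decomposition -[1+ n ] = ℤ.- 1ℤ , refl , sym (ℤ.-1*i≡-i (+ suc n))

-- A pair is a scalar `g` times a primitive integer vector `(x′ , y′)`; primitivity is witnessed by
-- Bézout coefficients. The action is a parameter because the scalar is an integer at first and a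
-- rational number later.
PrimitivePair : {A : Set} → (A → ℤ → A) → A → A → Set
PrimitivePair _∙_ x y = ∃ λ g → ∃ λ x′ → ∃ λ y′ → ∃ λ α → ∃ λ β →
  x ≡ g ∙ x′ × y ≡ g ∙ y′ × α ℤ.* x′ ℤ.+ β ℤ.* y′ ≡ 1ℤ

bézout-ℤ : ∀ {g m n} → Bézout.Identity g m n →
  ∃ λ α → ∃ λ β → α ℤ.* + m ℤ.+ β ℤ.* + n ≡ + g
bézout-ℤ {g} {m} {n} = λ where
    (Bézout.Identity.+- x y eq) → + x , ℤ.- + y , difference (+ x) (+ m) (+ y) (+ n) (cast g y n x m eq)
    (Bézout.Identity.-+ x y eq) → ℤ.- + x , + y ,
      trans (ℤ.+-comm (ℤ.- + x ℤ.* + m) (+ y ℤ.* + n)) (difference (+ y) (+ n) (+ x) (+ m) (cast g x m y n eq))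
  where
  cast : ∀ g y n x m → g ℕ.+ y ℕ.* n ≡ x ℕ.* m → + g ℤ.+ + y ℤ.* + n ≡ + x ℤ.* + m
  cast g y n x m eq =
    trans (cong (λ t → + g ℤ.+ t) (sym (ℤ.pos-* y n))) (trans (cong +_ eq) (ℤ.pos-* x m))
  cancel : ∀ g y n → (g ℤ.+ y ℤ.* n) ℤ.+ ℤ.- y ℤ.* n ≡ g
  cancel = solve 3 (λ g y n → (g :+ y :* n) :+ :- y :* n := g) refl
    where open ℤ.+-*-Solver
  difference : ∀ {g} x m y n → g ℤ.+ y ℤ.* n ≡ x ℤ.* m → x ℤ.* m ℤ.+ ℤ.- y ℤ.* n ≡ g
  difference {g} x m y n eq = trans (cong (ℤ._+ ℤ.- y ℤ.* n) (sym eq)) (cancel g y n)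

primitivePair-ℕ : ∀ m n → PrimitivePair ℤ._*_ (+ m) (+ n)
primitivePair-ℕ m n with Bézout.lemma m n
... | Bézout.result g gcd identity with GCD.commonDivisor gcd
... | divides m′ refl , divides n′ refl with g | bézout-ℤ identity
-- If the gcd is zero, both numbers vanish; the primitive vector may then be chosen freely, here as
-- `(1 , 0)`.
... | zero | _ =
  0ℤ , 1ℤ , 0ℤ , 1ℤ , 0ℤ , cong +_ (ℕ.*-zeroʳ m′) , cong +_ (ℕ.*-zeroʳ n′) , refl
... | g@(suc _) | α , β , eq = + g , + m′ , + n′ , α , β , pos m′ , pos n′ ,
  -- Dividing the Bézout identity by the nonzero gcd makes the cofactors unimodular.
  ℤ.*-cancelˡ-≡ (+ g) _ _ (begin
    + g ℤ.* (α ℤ.* + m′ ℤ.+ β ℤ.* + n′)           ≡⟨ rearrange (+ g) α (+ m′) β (+ n′) ⟩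
    α ℤ.* (+ g ℤ.* + m′) ℤ.+ β ℤ.* (+ g ℤ.* + n′) ≡⟨ cong₂ (λ x y → α ℤ.* x ℤ.+ β ℤ.* y) (pos m′) (pos n′) ⟨
    α ℤ.* + (m′ ℕ.* g) ℤ.+ β ℤ.* + (n′ ℕ.* g)     ≡⟨ eq ⟩
    + g                                           ≡⟨ ℤ.*-identityʳ (+ g) ⟨
    + g ℤ.* 1ℤ                                    ∎)
  where
  open ≡-Reasoning
  pos : ∀ k → + (k ℕ.* g) ≡ + g ℤ.* + k
  pos k = trans (ℤ.pos-* k g) (ℤ.*-comm (+ k) (+ g))
  rearrange : ∀ g α m β n →
    g ℤ.* (α ℤ.* m ℤ.+ β ℤ.* n) ≡ α ℤ.* (g ℤ.* m) ℤ.+ β ℤ.* (g ℤ.* n)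
  rearrange = solve 5 (λ g α m β n →
    g :* (α :* m :+ β :* n) := α :* (g :* m) :+ β :* (g :* n)) refl
    where open ℤ.+-*-Solver

primitivePair-ℤ : ∀ x y → PrimitivePair ℤ._*_ x y
primitivePair-ℤ x y
  with e , ee≡1 , x≡ ← sign-decomposition x
     | f , ff≡1 , y≡ ← sign-decomposition y
     | g , m , n , α , β , ∣x∣≡ , ∣y∣≡ , unimodular ← primitivePair-ℕ ℤ.∣ x ∣ ℤ.∣ y ∣
  = g , e ℤ.* m , f ℤ.* n , α ℤ.* e , β ℤ.* f
  , trans x≡ (trans (cong (e ℤ.*_) ∣x∣≡) (exchange e g m))
  , trans y≡ (trans (cong (f ℤ.*_) ∣y∣≡) (exchange f g n))
  , trans (cong₂ ℤ._+_ (square e α m ee≡1) (square f β n ff≡1)) unimodular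
  where
  open ℤ.+-*-Solver
  exchange : ∀ e g m → e ℤ.* (g ℤ.* m) ≡ g ℤ.* (e ℤ.* m)
  exchange = solve 3 (λ e g m → e :* (g :* m) := g :* (e :* m)) refl
  square : ∀ e α m → e ℤ.* e ≡ 1ℤ → (α ℤ.* e) ℤ.* (e ℤ.* m) ≡ α ℤ.* m
  square e α m ee≡1 = trans (regroup e α m)
    (trans (cong (ℤ._* (α ℤ.* m)) ee≡1) (ℤ.*-identityˡ (α ℤ.* m)))
    where
    regroup : ∀ e α m → (α ℤ.* e) ℤ.* (e ℤ.* m) ≡ (e ℤ.* e) ℤ.* (α ℤ.* m)
    regroup = solve 3 (λ e α m → (α :* e) :* (e :* m) := (e :* e) :* (α :* m)) refl

0<ι↧ : ∀ p → 0ℚ ℚ.< ι (↧ p)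
0<ι↧ p@record{} = ℚ.<-≤-trans (ℚ.positive⁻¹ 1ℚ) (ι-mono-≤ {1ℤ} {↧ p} (ℤ.+≤+ (ℕ.s≤s ℕ.z≤n)))

-- With `r` the inverse of the product of both denominators, `p` is `↥ p ℤ.* ↧ q` over that common
-- denominator.
clear-denominators : ∀ p q r g z → ↥ p ℤ.* ↧ q ≡ g ℤ.* z →
  (ι (↧ p) ℚ.* ι (↧ q)) ℚ.* r ≡ 1ℚ → p ≡ (ι g ℚ.* r) ℚ.* ι z
clear-denominators p q r g z eq inv = rearrange p (ι (↧ p)) (ι (↧ q)) r (ι g) (ι z) inv
  (trans (cong (ℚ._* ι (↧ q)) (p*↧p≡↥p p))
    (trans (sym (ι-* (↥ p) (↧ q))) (trans (cong ι eq) (ι-* g z))))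
  where
  rearrange : ∀ p m n r g z → (m ℚ.* n) ℚ.* r ≡ 1ℚ → (p ℚ.* m) ℚ.* n ≡ g ℚ.* z →
    p ≡ (g ℚ.* r) ℚ.* z
  rearrange p m n r g z inv eq = begin
    p                         ≡⟨ ℚ.*-identityʳ p ⟨
    p ℚ.* 1ℚ                  ≡⟨ cong (p ℚ.*_) inv ⟨
    p ℚ.* ((m ℚ.* n) ℚ.* r)   ≡⟨ regroup p m n r ⟩
    ((p ℚ.* m) ℚ.* n) ℚ.* r   ≡⟨ cong (ℚ._* r) eq ⟩
    (g ℚ.* z) ℚ.* r           ≡⟨ exchange g z r ⟩
    (g ℚ.* r) ℚ.* z           ∎
    where
    open ≡-Reasoning
    open ℚ.+-*-Solver
    regroup : ∀ p m n r → p ℚ.* ((m ℚ.* n) ℚ.* r) ≡ ((p ℚ.* m) ℚ.* n) ℚ.* r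
    regroup = solve 4 (λ p m n r → p :* ((m :* n) :* r) := ((p :* m) :* n) :* r) refl
    exchange : ∀ g z r → (g ℚ.* z) ℚ.* r ≡ (g ℚ.* r) ℚ.* z
    exchange = solve 3 (λ g z r → (g :* z) :* r := (g :* r) :* z) refl

primitivePair-ℚ : ∀ p q → PrimitivePair (λ c z → c ℚ.* ι z) p q
primitivePair-ℚ p q =
  let g , x , y , α , β , eq₁ , eq₂ , unimodular = primitivePair-ℤ (↥ p ℤ.* ↧ q) (↥ q ℤ.* ↧ p)
      r , _ , inv = inverse (*-pos (0<ι↧ p) (0<ι↧ q))
  in ι g ℚ.* r , x , y , α , β
  , clear-denominators p q r g x eq₁ inv
  , clear-denominators q p r g y eq₂ (trans (cong (ℚ._* r) (ℚ.*-comm (ι (↧ q)) (ι (↧ p)))) inv)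
  , unimodular

-- Induction on the dimension: if the tail is `c′` times a primitive `b`, factor the pair of the
-- head and `c′` as `c` times a primitive `(x , y)`. Then `(x , y b)` is primitive, with dual
-- functional `(α , β u)`.
primitiveVector : ∀ {n} (v : Vector ℚ (suc n)) →
  ∃ λ (c : ℚ) → ∃ λ (b : Vector ℤ (suc n)) → ∃ λ (u : Vector ℤ (suc n)) →
    (∀ i → v i ≡ c ℚ.* ι (b i)) × dot u b ≡ 1ℤ
primitiveVector {zero} v =
  -- In dimension one the vector `1` is always taken, so a zero entry is absorbed by `c` and needs
  -- no separate case.
  v zero , (λ _ → 1ℤ) , (λ _ → 1ℤ) , (λ { zero → sym (ℚ.*-identityʳ (v zero)) }) , refl
primitiveVector {suc n} v =
  let c′ , b , u , v≡c′b , u·b≡1 = primitiveVector (tail v)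
      c , x , y , α , β , v₀≡cx , c′≡cy , αx+βy≡1 = primitivePair-ℚ (head v) c′
  in c , x ◂ (λ i → y ℤ.* b i) , α ◂ (λ i → β ℤ.* u i)
  , (λ { zero → v₀≡cx ; (suc i) → rescale c′ c y (b i) (v≡c′b i) c′≡cy })
  , trans (cong (λ t → α ℤ.* x ℤ.+ t) (scaled β y u b u·b≡1)) αx+βy≡1
  where
  open ≡-Reasoning
  rescale : ∀ c′ c y b {q} → q ≡ c′ ℚ.* ι b → c′ ≡ c ℚ.* ι y → q ≡ c ℚ.* ι (y ℤ.* b)
  rescale c′ c y b {q} q≡ c′≡ = begin
    q                   ≡⟨ q≡ ⟩
    c′ ℚ.* ι b          ≡⟨ cong (ℚ._* ι b) c′≡ ⟩
    (c ℚ.* ι y) ℚ.* ι b ≡⟨ ℚ.*-assoc c (ι y) (ι b) ⟩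
    c ℚ.* (ι y ℚ.* ι b) ≡⟨ cong (c ℚ.*_) (ι-* y b) ⟨
    c ℚ.* ι (y ℤ.* b)   ∎
  scaled : ∀ β y (u b : Vector ℤ (suc n)) → dot u b ≡ 1ℤ →
    dot (λ i → β ℤ.* u i) (λ i → y ℤ.* b i) ≡ β ℤ.* y
  scaled β y u b u·b≡1 = begin
    dot (λ i → β ℤ.* u i) (λ i → y ℤ.* b i) ≡⟨ dot-*ˡ β u (λ i → y ℤ.* b i) ⟩
    β ℤ.* dot u (λ i → y ℤ.* b i)           ≡⟨ cong (β ℤ.*_) (dot-*ʳ y u b) ⟩
    β ℤ.* (y ℤ.* dot u b)                   ≡⟨ cong (λ t → β ℤ.* (y ℤ.* t)) u·b≡1 ⟩
    β ℤ.* (y ℤ.* 1ℤ)                        ≡⟨ cong (β ℤ.*_) (ℤ.*-identityʳ y) ⟩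
    β ℤ.* y                                 ∎

-- Integers confined to short intervals

-- The bounds place `D t` in `[a - B , a + B]`, which lies inside the open interval from `0` to `D`;
-- hence `0 < t < 1`. In the application `t` is the value of `u` at a lattice point.
no-integer-between : ∀ {D a B} t → 0ℚ ℚ.< D → ∣ D ℚ.* ι t ℚ.- a ∣ ℚ.≤ B →
  B ℚ.< a → ¬ a ℚ.+ B ℚ.< D
no-integer-between {D} {a} {B} t 0<D near B<a a+B<D = ℚ.<-irrefl refl (begin-strict
  a ℚ.+ B      <⟨ a+B<D ⟩
  D            ≡⟨ ℚ.*-identityʳ D ⟨
  D ℚ.* 1ℚ     ≤⟨ ℚ.*-monoˡ-≤-nonNeg D (ι-mono-≤ (ℤ.i<j⇒suc[i]≤j 0<t)) ⟩
  D ℚ.* ι t    ≡⟨ split (D ℚ.* ι t) a ⟩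
  a ℚ.+ (D ℚ.* ι t ℚ.- a) ≤⟨ ℚ.+-monoʳ-≤ a (ℚ.≤-trans (p≤∣p∣ _) near) ⟩
  a ℚ.+ B      ∎)
  where
  open ℚ.≤-Reasoning
  open ℚ.+-*-Solver
  instance
    D-nonNeg : ℚ.NonNegative D
    D-nonNeg = ℚ.nonNegative (ℚ.<⇒≤ 0<D)
  split : ∀ x a → x ≡ a ℚ.+ (x ℚ.- a)
  split = solve 2 (λ x a → x := a :+ (x :- a)) refl
  gap : ∀ x a → a ℚ.- ℚ.- (x ℚ.- a) ≡ x ℚ.- 0ℚ
  gap = solve 2 (λ x a → a :- :- (x :- a) := x :- con 0ℚ) refl
  0<Dt : D ℚ.* 0ℚ ℚ.< D ℚ.* ι t
  0<Dt = subst (ℚ._< D ℚ.* ι t) (sym (ℚ.*-zeroʳ D))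
    (<-from-gap (ℚ.≤-<-trans (ℚ.≤-trans (-p≤∣p∣ _) near) B<a) (gap (D ℚ.* ι t) a))
  0<t : 0ℤ ℤ.< t
  0<t = ι-cancel-< (ℚ.*-cancelˡ-<-nonNeg D 0<Dt)

-- A nonzero integer has absolute value at least one, which would make `∣ D t ∣` at least `D`.
small-integer : ∀ {D B} t → 0ℚ ℚ.< D → ∣ D ℚ.* ι t ∣ ℚ.≤ B → B ℚ.< D → t ≡ 0ℤ
small-integer {D} {B} t 0<D near B<D with ℤ.<-cmp t 0ℤ
... | tri≈ _ t≡0 _ = t≡0
... | tri> _ _ 0<t = contradiction (begin-strict
  D          ≡⟨ ℚ.*-identityʳ D ⟨
  D ℚ.* 1ℚ   ≤⟨ ℚ.*-monoˡ-≤-nonNeg D {{ℚ.nonNegative (ℚ.<⇒≤ 0<D)}} (ι-mono-≤ (ℤ.i<j⇒suc[i]≤j 0<t)) ⟩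
  D ℚ.* ι t  ≤⟨ p≤∣p∣ _ ⟩
  ∣ D ℚ.* ι t ∣ ≤⟨ near ⟩
  B          <⟨ B<D ⟩
  D          ∎) (ℚ.<-irrefl refl)
  where open ℚ.≤-Reasoning
... | tri< t<0 _ _ = contradiction (begin-strict
  D                ≡⟨ neg-one D ⟨
  ℚ.- (D ℚ.* ι (ℤ.- 1ℤ)) ≤⟨ ℚ.neg-antimono-≤
                              (ℚ.*-monoˡ-≤-nonNeg D {{ℚ.nonNegative (ℚ.<⇒≤ 0<D)}} (ι-mono-≤ (ℤ.i<j⇒i≤pred[j] t<0))) ⟩
  ℚ.- (D ℚ.* ι t)  ≤⟨ -p≤∣p∣ _ ⟩
  ∣ D ℚ.* ι t ∣    ≤⟨ near ⟩
  B                <⟨ B<D ⟩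
  D                ∎) (ℚ.<-irrefl refl)
  where
  open ℚ.≤-Reasoning
  neg-one : ∀ D → ℚ.- (D ℚ.* ι (ℤ.- 1ℤ)) ≡ D
  neg-one = solve 1 (λ D → :- (D :* con (ι (ℤ.- 1ℤ))) := D) refl
    where open ℚ.+-*-Solver

-- By linearity the difference is the sum of `u i` times the coordinate errors; the triangle
-- inequality does the rest.
dot-near : ∀ {n} D R (u z w : Vector ℤ n) → (∀ i → ∣ D ℚ.* ι (z i) ℚ.- ι (w i) ∣ ℚ.≤ R) →
  ∣ D ℚ.* ι (dot u z) ℚ.- ι (dot u w) ∣ ℚ.≤ ℚΣ.sum (λ i → ∣ ι (u i) ∣ ℚ.* R)
dot-near D R u z w near = subst (λ q → ∣ q ∣ ℚ.≤ _) (sym (expand u z w))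
  (∣sum∣≤sum _ _ λ i → subst (ℚ._≤ ∣ ι (u i) ∣ ℚ.* R) (sym (ℚ.∣p*q∣≡∣p∣*∣q∣ (ι (u i)) _))
    (ℚ.*-monoˡ-≤-nonNeg ∣ ι (u i) ∣ {{ℚ.∣-∣-nonNeg (ι (u i))}} (near i)))
  where
  open ℚ.+-*-Solver
  ι-dot : ∀ a b s → ι (a ℤ.* b ℤ.+ s) ≡ ι a ℚ.* ι b ℚ.+ ι s
  ι-dot a b s = trans (ι-+ (a ℤ.* b) s) (cong (ℚ._+ ι s) (ι-* a b))
  rearrange : ∀ D u z w s t → D ℚ.* (u ℚ.* z ℚ.+ s) ℚ.- (u ℚ.* w ℚ.+ t) ≡
    u ℚ.* (D ℚ.* z ℚ.- w) ℚ.+ (D ℚ.* s ℚ.- t)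
  rearrange = solve 6 (λ D u z w s t → D :* (u :* z :+ s) :- (u :* w :+ t) :=
    u :* (D :* z :- w) :+ (D :* s :- t)) refl
  expand : ∀ {n} (u z w : Vector ℤ n) → D ℚ.* ι (dot u z) ℚ.- ι (dot u w) ≡
    ℚΣ.sum (λ i → ι (u i) ℚ.* (D ℚ.* ι (z i) ℚ.- ι (w i)))
  expand {zero}  u z w = trans (ℚ.+-identityʳ (D ℚ.* 0ℚ)) (ℚ.*-zeroʳ D)
  expand {suc n} u z w = trans
    (cong₂ (λ p q → D ℚ.* p ℚ.- q) (ι-dot (head u) (head z) _) (ι-dot (head u) (head w) _))
    (trans (rearrange D (ι (head u)) (ι (head z)) (ι (head w)) _ _)
      (cong (λ t → ι (head u) ℚ.* (D ℚ.* ι (head z) ℚ.- ι (head w)) ℚ.+ t)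
        (expand (tail u) (tail z) (tail w))))

-- Bounds on polytopes

Eventually : (ℕ → Set) → Set
Eventually A = ∃[ N ] ∀ n → N ℕ.≤ n → A n

eventually-map : ∀ {A B : ℕ → Set} → (∀ {n} → A n → B n) → Eventually A → Eventually B
eventually-map f (N , a) = N , λ n n≥ → f (a n n≥)

eventually-× : ∀ {A B : ℕ → Set} → Eventually A → Eventually B → Eventually λ n → A n × B n
eventually-× (M , a) (N , b) = M ℕ.⊔ N , λ n n≥ →
  a n (ℕ.≤-trans (ℕ.m≤m⊔n M N) n≥) , b n (ℕ.≤-trans (ℕ.m≤n⊔m M N) n≥)

eventually-∀ : ∀ {m} {A : Fin m → ℕ → Set} →
  (∀ j → Eventually (A j)) → Eventually λ n → ∀ j → A j n
eventually-∀ {zero}  a = 0 , λ _ _ ()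
eventually-∀ {suc m} a = eventually-map (λ { (a₀ , _) zero → a₀ ; (_ , a₊) (suc j) → a₊ j })
  (eventually-× (a zero) (eventually-∀ (a ∘ suc)))

≡⇒≈ : ∀ {x y} → (∀ n → seq x n ≡ seq y n) → x ≈ y
≡⇒≈ {x} {y} x≡y ε 0<ε = 0 , λ n _ → subst (λ q → ∣ q ∣ ℚ.< ε)
  (sym (trans (cong (ℚ._- seq y n) (x≡y n)) (ℚ.+-inverseʳ (seq y n)))) 0<ε

fromℚ-nonNeg : ∀ q → 0ℚ ℚ.≤ q → 0ℝ ≤ fromℚ q
fromℚ-nonNeg q 0≤q ε 0<ε = 0 , λ _ _ → ℚ.+-mono-≤-< 0≤q 0<ε

seq-sum : ∀ {m} (f : Vector ℝ m) n → seq (sum f) n ≡ ℚΣ.sum (λ j → seq (f j) n)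
seq-sum {zero}  f n = refl
seq-sum {suc m} f n = cong (λ t → seq (head f) n ℚ.+ t) (seq-sum (tail f) n)

-- The bound is uniform over points and coordinates, while the index from which it holds may vary.
-- It concerns approximating sequences, so later estimates stay within the rationals.
EventuallyBounded : ∀ {d} → Subset d → ℚ → Set
EventuallyBounded P R = ∀ {x} → x ∈ P → ∀ i → Eventually λ n → ∣ seq (x i) n ∣ ℚ.≤ R

2ℚ : ℚ
2ℚ = 1ℚ ℚ.+ 1ℚ

-- At a fixed index the coefficients of a convex combination are nonnegative and sum to one only up
-- to an error, here taken to be 1. From `c > -1` follows `∣ c ∣ ≤ c + 2`, and the sum of the
-- coefficients is below 2.
combination-bound : ∀ {m} (c v : Vector ℚ m) V → (∀ j → ∣ v j ∣ ℚ.≤ V) → 0ℚ ℚ.≤ V →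
  (∀ j → 0ℚ ℚ.< c j ℚ.+ 1ℚ) → ∣ ℚΣ.sum c ℚ.- 1ℚ ∣ ℚ.< 1ℚ →
  ∣ ℚΣ.sum (λ j → c j ℚ.* v j) ∣ ℚ.≤ (2ℚ ℚ.+ ℚΣ.sum {m} λ _ → 2ℚ) ℚ.* V
combination-bound {m} c v V v≤V 0≤V c>-1 Σc≈1 = begin
  ∣ ℚΣ.sum (λ j → c j ℚ.* v j) ∣
    ≤⟨ ∣sum∣≤sum _ _ term ⟩
  ℚΣ.sum (λ j → (c j ℚ.+ 2ℚ) ℚ.* V)
    ≡⟨ ℚΣ.*-distribʳ-sum V (λ j → c j ℚ.+ 2ℚ) ⟨
  ℚΣ.sum (λ j → c j ℚ.+ 2ℚ) ℚ.* V
    ≡⟨ cong (ℚ._* V) (ℚΣ.∑-distrib-+ c (λ _ → 2ℚ)) ⟩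
  (ℚΣ.sum c ℚ.+ ℚΣ.sum {m} λ _ → 2ℚ) ℚ.* V
    ≤⟨ ℚ.*-monoʳ-≤-nonNeg V (ℚ.+-monoˡ-≤ (ℚΣ.sum {m} λ _ → 2ℚ) (ℚ.<⇒≤ Σc<2)) ⟩
  (2ℚ ℚ.+ ℚΣ.sum {m} λ _ → 2ℚ) ℚ.* V ∎
  where
  open ℚ.≤-Reasoning
  open ℚ.+-*-Solver
  instance
    V-nonNeg : ℚ.NonNegative V
    V-nonNeg = ℚ.nonNegative 0≤V
  gap₁ : ∀ s → 1ℚ ℚ.- (s ℚ.- 1ℚ) ≡ 2ℚ ℚ.- s
  gap₁ = solve 1 (λ s → con 1ℚ :- (s :- con 1ℚ) := con 2ℚ :- s) refl
  Σc<2 : ℚΣ.sum c ℚ.< 2ℚ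
  Σc<2 = <-from-gap (ℚ.≤-<-trans (p≤∣p∣ _) Σc≈1) (gap₁ (ℚΣ.sum c))
  gap₂ : ∀ c → (c ℚ.+ 1ℚ) ℚ.+ (c ℚ.+ 1ℚ) ℚ.- 0ℚ ≡ (c ℚ.+ 2ℚ) ℚ.- (ℚ.- c)
  gap₂ = solve 1 (λ c → (c :+ con 1ℚ) :+ (c :+ con 1ℚ) :- con 0ℚ := (c :+ con 2ℚ) :- :- c) refl
  ∣c∣≤ : ∀ c → 0ℚ ℚ.< c ℚ.+ 1ℚ → ∣ c ∣ ℚ.≤ c ℚ.+ 2ℚ
  ∣c∣≤ c 0<c+1 with ℚ.∣p∣≡p∨∣p∣≡-p c
  ... | inj₁ eq = begin
    ∣ c ∣       ≡⟨ eq ⟩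
    c           ≡⟨ ℚ.+-identityʳ c ⟨
    c ℚ.+ 0ℚ    ≤⟨ ℚ.+-monoʳ-≤ c (ℚ.nonNegative⁻¹ 2ℚ) ⟩
    c ℚ.+ 2ℚ    ∎
  ... | inj₂ eq = subst (ℚ._≤ c ℚ.+ 2ℚ) (sym eq)
    (ℚ.<⇒≤ (<-from-gap (ℚ.+-mono-< 0<c+1 0<c+1) (gap₂ c)))
  term : ∀ j → ∣ c j ℚ.* v j ∣ ℚ.≤ (c j ℚ.+ 2ℚ) ℚ.* V
  term j = begin
    ∣ c j ℚ.* v j ∣      ≡⟨ ℚ.∣p*q∣≡∣p∣*∣q∣ (c j) (v j) ⟩
    ∣ c j ∣ ℚ.* ∣ v j ∣  ≤⟨ ℚ.*-monoˡ-≤-nonNeg ∣ c j ∣ {{ℚ.∣-∣-nonNeg (c j)}} (v≤V j) ⟩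
    ∣ c j ∣ ℚ.* V        ≤⟨ ℚ.*-monoʳ-≤-nonNeg V (∣c∣≤ (c j) (c>-1 j)) ⟩
    (c j ℚ.+ 2ℚ) ℚ.* V   ∎

-- The summand `1ℚ` pays for the approximation of the point by its convex combination.
convexHull-bounded : ∀ {d m} (v : Vector (Vector ℚ d) m) → ∃ (EventuallyBounded (convexHull v))
convexHull-bounded {d} {m} v = 1ℚ ℚ.+ B , λ {x} (c , c≥0 , Σc≈1 , x≈Σcv) i →
  eventually-map
    (λ {n} (c>-1 , Σc≈ₙ1 , x≈ₙΣcv) → near (seq (x i) n) _ x≈ₙΣcv
      (subst (λ q → ∣ q ∣ ℚ.≤ B) (sym (seq-sum (λ j → c j * fromℚ (v j i)) n))
        (combination-bound (λ j → seq (c j) n) (λ j → v j i) V (λ j → v≤V j i) 0≤V c>-1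
          (subst (λ q → ∣ q ℚ.- 1ℚ ∣ ℚ.< 1ℚ) (seq-sum c n) Σc≈ₙ1))))
    (eventually-× (eventually-∀ λ j → c≥0 j 1ℚ 0<1)
      (eventually-× (Σc≈1 1ℚ 0<1) (x≈Σcv i 1ℚ 0<1)))
  where
  V = ℚΣ.sum λ j → ℚΣ.sum λ i → ∣ v j i ∣
  0≤row : ∀ j → 0ℚ ℚ.≤ ℚΣ.sum λ i → ∣ v j i ∣
  0≤row j = sum-nonNeg _ λ i → ℚ.0≤∣p∣ (v j i)
  0≤V : 0ℚ ℚ.≤ V
  0≤V = sum-nonNeg _ 0≤row
  v≤V : ∀ j i → ∣ v j i ∣ ℚ.≤ V
  v≤V j i = ℚ.≤-trans (term≤sum _ (λ i → ℚ.0≤∣p∣ (v j i)) i) (term≤sum _ 0≤row j)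
  0<1 : 0ℚ ℚ.< 1ℚ
  0<1 = ℚ.positive⁻¹ 1ℚ
  B = (2ℚ ℚ.+ ℚΣ.sum {m} λ _ → 2ℚ) ℚ.* V
  near : ∀ x y → ∣ x ℚ.- y ∣ ℚ.< 1ℚ → ∣ y ∣ ℚ.≤ B → ∣ x ∣ ℚ.≤ 1ℚ ℚ.+ B
  near x y x≈y y≤B = begin
    ∣ x ∣                      ≡⟨ cong ∣_∣ (split x y) ⟩
    ∣ (x ℚ.- y) ℚ.+ y ∣        ≤⟨ ℚ.∣p+q∣≤∣p∣+∣q∣ (x ℚ.- y) y ⟩
    ∣ x ℚ.- y ∣ ℚ.+ ∣ y ∣      ≤⟨ ℚ.+-mono-≤ (ℚ.<⇒≤ x≈y) y≤B ⟩
    1ℚ ℚ.+ B                   ∎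
    where
    open ℚ.≤-Reasoning
    split : ∀ x y → x ≡ (x ℚ.- y) ℚ.+ y
    split = solve 2 (λ x y → x := (x :- y) :+ y) refl
      where open ℚ.+-*-Solver

-- The coefficients are 1 at the first point and 0 elsewhere. The vector `q` is separate from
-- `v zero` because the factored form of a vector agrees with it only coordinatewise.
vertex∈convexHull : ∀ {d m} (v : Vector (Vector ℚ d) (suc m)) {q : Vector ℚ d} →
  (∀ i → q i ≡ v zero i) → (λ i → fromℚ (q i)) ∈ convexHull v
vertex∈convexHull {m = m} v {q} q≡v₀ = c , c≥0
  , ≡⇒≈ {sum c} {1ℝ} (λ n → trans (seq-sum c n) (cong (1ℚ ℚ.+_) (zeros {m} λ _ → refl)))
  , λ i → ≡⇒≈ {fromℚ (q i)} {sum λ j → c j * fromℚ (v j i)} λ n → sym (begin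
      seq (sum λ j → c j * fromℚ (v j i)) n
        ≡⟨ seq-sum (λ j → c j * fromℚ (v j i)) n ⟩
      1ℚ ℚ.* v zero i ℚ.+ ℚΣ.sum {m} (λ j → 0ℚ ℚ.* v (suc j) i)
        ≡⟨ cong₂ ℚ._+_ (ℚ.*-identityˡ (v zero i)) (zeros {m} λ j → ℚ.*-zeroˡ (v (suc j) i)) ⟩
      v zero i ℚ.+ 0ℚ
        ≡⟨ ℚ.+-identityʳ (v zero i) ⟩
      v zero i
        ≡⟨ q≡v₀ i ⟨
      q i ∎)
  where
  open ≡-Reasoning
  c : Vector ℝ (suc m)
  c = 1ℝ ◂ λ _ → 0ℝ
  c≥0 : ∀ j → 0ℝ ≤ c j
  c≥0 zero    = fromℚ-nonNeg 1ℚ (ℚ.nonNegative⁻¹ 1ℚ)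
  c≥0 (suc j) = fromℚ-nonNeg 0ℚ ℚ.≤-refl
  zeros : ∀ {m} {f : Vector ℚ m} → (∀ j → f j ≡ 0ℚ) → ℚΣ.sum f ≡ 0ℚ
  zeros {m} f≡0 = trans (ℚΣ.sum-cong-≗ f≡0) (ℚΣ.sum-replicate-zero m)

-- Lattice points of dilated translates

-- Since `D σ = 1`, the difference `D z - w` is the sum of `D (z - σ y)`, `y - (x + w)` and `x`. The
-- tolerance in the last hypothesis becomes `A - (1 + R)` after multiplication by `D`, so the three
-- terms would add up to less than `A` itself.
undilate : ∀ {D σ R} x y z w → 0ℚ ℚ.< D → D ℚ.* σ ≡ 1ℚ →
  ∣ y ℚ.- (x ℚ.+ w) ∣ ℚ.< 1ℚ → ∣ x ∣ ℚ.≤ R →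
  ¬ ∣ z ℚ.- σ ℚ.* y ∣ ℚ.< σ ℚ.* (∣ D ℚ.* z ℚ.- w ∣ ℚ.- (1ℚ ℚ.+ R))
undilate {D} {σ} {R} x y z w 0<D Dσ≡1 y≈x+w x≤R z≈σy = ℚ.<-irrefl refl (begin-strict
  A
    ≡⟨ cong ∣_∣ (trans (split (D ℚ.* z) w y x)
        (cong (λ t → ((D ℚ.* z ℚ.- t) ℚ.+ (y ℚ.- (x ℚ.+ w))) ℚ.+ x) (sym (cancel y)))) ⟩
  ∣ ((D ℚ.* z ℚ.- D ℚ.* (σ ℚ.* y)) ℚ.+ (y ℚ.- (x ℚ.+ w))) ℚ.+ x ∣
    ≤⟨ ℚ.≤-trans (ℚ.∣p+q∣≤∣p∣+∣q∣ ((D ℚ.* z ℚ.- D ℚ.* (σ ℚ.* y)) ℚ.+ (y ℚ.- (x ℚ.+ w))) x)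
         (ℚ.+-monoˡ-≤ ∣ x ∣ (ℚ.∣p+q∣≤∣p∣+∣q∣ (D ℚ.* z ℚ.- D ℚ.* (σ ℚ.* y)) (y ℚ.- (x ℚ.+ w)))) ⟩
  (∣ D ℚ.* z ℚ.- D ℚ.* (σ ℚ.* y) ∣ ℚ.+ ∣ y ℚ.- (x ℚ.+ w) ∣) ℚ.+ ∣ x ∣
    <⟨ ℚ.+-mono-<-≤ (ℚ.+-mono-< scaled y≈x+w) x≤R ⟩
  ((A ℚ.- (1ℚ ℚ.+ R)) ℚ.+ 1ℚ) ℚ.+ R
    ≡⟨ collect A R ⟩
  A ∎)
  where
  open ℚ.≤-Reasoning
  open ℚ.+-*-Solver
  A = ∣ D ℚ.* z ℚ.- w ∣
  instance
    D-pos : ℚ.Positive D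
    D-pos = ℚ.positive 0<D
    D-nonNeg : ℚ.NonNegative D
    D-nonNeg = ℚ.pos⇒nonNeg D
  cancel : ∀ t → D ℚ.* (σ ℚ.* t) ≡ t
  cancel t = trans (sym (ℚ.*-assoc D σ t)) (trans (cong (ℚ._* t) Dσ≡1) (ℚ.*-identityˡ t))
  split : ∀ p w y x → p ℚ.- w ≡ ((p ℚ.- y) ℚ.+ (y ℚ.- (x ℚ.+ w))) ℚ.+ x
  split = solve 4 (λ p w y x → p :- w := ((p :- y) :+ (y :- (x :+ w))) :+ x) refl
  collect : ∀ A R → ((A ℚ.- (1ℚ ℚ.+ R)) ℚ.+ 1ℚ) ℚ.+ R ≡ A
  collect = solve 2 (λ A R → ((A :- (con 1ℚ :+ R)) :+ con 1ℚ) :+ R := A) refl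
  factor : ∀ D z y → D ℚ.* z ℚ.- D ℚ.* y ≡ D ℚ.* (z ℚ.- y)
  factor = solve 3 (λ D z y → D :* z :- D :* y := D :* (z :- y)) refl
  scaled : ∣ D ℚ.* z ℚ.- D ℚ.* (σ ℚ.* y) ∣ ℚ.< A ℚ.- (1ℚ ℚ.+ R)
  scaled = begin-strict
    ∣ D ℚ.* z ℚ.- D ℚ.* (σ ℚ.* y) ∣   ≡⟨ cong ∣_∣ (factor D z (σ ℚ.* y)) ⟩
    ∣ D ℚ.* (z ℚ.- σ ℚ.* y) ∣         ≡⟨ ℚ.∣p*q∣≡∣p∣*∣q∣ D (z ℚ.- σ ℚ.* y) ⟩
    ∣ D ∣ ℚ.* ∣ z ℚ.- σ ℚ.* y ∣       ≡⟨ cong (ℚ._* ∣ z ℚ.- σ ℚ.* y ∣) (ℚ.0≤p⇒∣p∣≡p (ℚ.<⇒≤ 0<D)) ⟩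
    D ℚ.* ∣ z ℚ.- σ ℚ.* y ∣           <⟨ ℚ.*-monoʳ-<-pos D z≈σy ⟩
    D ℚ.* (σ ℚ.* (A ℚ.- (1ℚ ℚ.+ R)))  ≡⟨ cancel _ ⟩
    A ℚ.- (1ℚ ℚ.+ R)                  ∎

-- Scaling back by `D` puts `D z - w` in `P`, whose coordinates are bounded by `R`; the extra 1
-- absorbs the error of one approximation. Rational order allows a proof by contradiction, where the
-- assumed excess over `1 + R` supplies the tolerance for the other approximation.
lattice-near : ∀ {d} (P : Subset d) D σ R → EventuallyBounded P R →
  0ℚ ℚ.< D → 0ℚ ℚ.< σ → D ℚ.* σ ≡ 1ℚ → ∀ z w → embed z ∈ fromℚ σ · (P +ᵗ w) →
  ∀ i → ∣ D ℚ.* ι (Vec.lookup z i) ℚ.- ι (Vec.lookup w i) ∣ ℚ.≤ 1ℚ ℚ.+ R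
lattice-near P D σ R bounded 0<D 0<σ Dσ≡1 z w (y , (x , x∈P , y≈x+w) , z≈σy) i =
  ℚ.≮⇒≥ λ 1+R<A →
    -- A single index at which all three estimates hold is enough.
    let N , p = eventually-× (z≈σy i _ (*-pos 0<σ (0<gap 1+R<A)))
                  (eventually-× (y≈x+w i 1ℚ (ℚ.positive⁻¹ 1ℚ)) (bounded x∈P i))
        z≈ , y≈ , x≤R = p N ℕ.≤-refl
    in undilate (seq (x i) N) (seq (y i) N) (ι (Vec.lookup z i)) (ι (Vec.lookup w i))
         0<D Dσ≡1 y≈ x≤R z≈
  where
  0<gap : ∀ {p q} → p ℚ.< q → 0ℚ ℚ.< q ℚ.- p
  0<gap {p} {q} p<q = <-from-gap p<q (sym (ℚ.+-identityʳ (q ℚ.- p)))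

-- The same `y` serves for both dilates: if `σ y` is zero, so is its half. Halving the error permits
-- the tolerance `ε + ε` at the start.
halve-origin : ∀ {d} (Q : Subset d) σ z → (∀ i → Vec.lookup z i ≡ 0ℤ) →
  embed z ∈ fromℚ σ · Q → embed z ∈ fromℚ (½ ℚ.* σ) · Q
halve-origin Q σ z z≡0 (y , y∈Q , z≈σy) = y , y∈Q , λ i ε 0<ε →
  let N , p = z≈σy i (ε ℚ.+ ε) (ℚ.+-mono-< 0<ε 0<ε) in
  N , λ n n≥ → half ε (seq (y i) n) (z≡0 i) (p n n≥)
  where
  open ℚ.≤-Reasoning
  open ℚ.+-*-Solver
  factor : ∀ s y → 0ℚ ℚ.- (½ ℚ.* s) ℚ.* y ≡ ½ ℚ.* (0ℚ ℚ.- s ℚ.* y)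
  factor = solve 2 (λ s y → con 0ℚ :- (con ½ :* s) :* y := con ½ :* (con 0ℚ :- s :* y)) refl
  double : ∀ ε → ½ ℚ.* (ε ℚ.+ ε) ≡ ε
  double = solve 1 (λ ε → con ½ :* (ε :+ ε) := ε) refl
  half : ∀ ε y {t} → t ≡ 0ℤ → ∣ ι t ℚ.- σ ℚ.* y ∣ ℚ.< ε ℚ.+ ε →
    ∣ ι t ℚ.- (½ ℚ.* σ) ℚ.* y ∣ ℚ.< ε
  half ε y refl near = begin-strict
    ∣ 0ℚ ℚ.- (½ ℚ.* σ) ℚ.* y ∣    ≡⟨ cong ∣_∣ (factor σ y) ⟩
    ∣ ½ ℚ.* (0ℚ ℚ.- σ ℚ.* y) ∣    ≡⟨ ℚ.∣p*q∣≡∣p∣*∣q∣ ½ (0ℚ ℚ.- σ ℚ.* y) ⟩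
    ½ ℚ.* ∣ 0ℚ ℚ.- σ ℚ.* y ∣      <⟨ ℚ.*-monoʳ-<-pos ½ near ⟩
    ½ ℚ.* (ε ℚ.+ ε)               ≡⟨ double ε ⟩
    ε                             ∎

-- Ehrhart functions compared through empty dilates

SameEhrhart-sym : ∀ {d} (P Q : Subset d) → SameEhrhart P Q → SameEhrhart Q P
SameEhrhart-sym P Q same s 0≤s n =
  mk⇔ (Equivalence.from (same s 0≤s n)) (Equivalence.to (same s 0≤s n))

-- Counts are given only as a relation, and a count for `s · P` need not be computable. An empty
-- dilate does have a count, 0, witnessed by the empty list; carried over to `P`, it excludes the
-- point `z`.
SameEhrhart⇒¬empty : ∀ {d} (P Q : Subset d) → SameEhrhart P Q → ∀ s → 0ℝ ≤ s →
  ∀ z → embed z ∈ s · P → ¬ (∀ z′ → embed z′ ∉ s · Q)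
SameEhrhart⇒¬empty P Q same s 0≤s z z∈sP empty
  with Equivalence.from (same s 0≤s 0)
    ([] , [] , (λ {z′} → mk⇔ (λ ()) (λ z′∈sQ → contradiction z′∈sQ (empty z′))) , refl)
... | [] , _ , ∈⇔∈sP , refl with () ← Equivalence.from (∈⇔∈sP {z}) z∈sP

-- Translates along the primitive direction `b`

module Translates {d} {P : Subset d} {R} (bounded : EventuallyBounded P R)
  (c : ℚ) (b u : Vector ℤ d) (cb∈P : (λ i → fromℚ (c ℚ.* ι (b i))) ∈ P) (u·b≡1 : dot u b ≡ 1ℤ)
  where

  -- The error of `u` that `dot-near` yields from the coordinate error `1 + R` of `lattice-near`; it
  -- is the half-width of the slabs.
  B : ℚ
  B = ℚΣ.sum λ i → ∣ ι (u i) ∣ ℚ.* (1ℚ ℚ.+ R)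

  -- As `c` may be negative, `M` must compensate for it. In order, the hypotheses leave only the
  -- origin as a possible lattice point of the dilate of `P`, keep the slab above 0, keep it below 1
  -- for dilation and then for half the dilation, and make the dilation factors positive.
  module Scaled (M : ℕ)
    (1+R<M+c : 1ℚ ℚ.+ R ℚ.< ι (+ M) ℚ.+ c) (B<M : B ℚ.< ι (+ M))
    (B<M+c : B ℚ.< ι (+ M) ℚ.+ c) (B<M+2c : B ℚ.< ι (+ M) ℚ.+ (c ℚ.+ c))
    (0<M+c : 0ℚ ℚ.< ι (+ M) ℚ.+ c)
    where

    w : Vec ℤ d
    w = Vec.tabulate λ i → + M ℤ.* b i

    -- The value of `u` at `k • w`.
    height : ℕ → ℚ
    height k = ι (+ (k ℕ.* M))

    -- The value of `u` at the translate of `c b` by `k • w`, which is this multiple of `b`; its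
    -- inverse is the dilation carrying that point to `b`.
    dilation : ℕ → ℚ
    dilation k = height k ℚ.+ c

    height-+ : ∀ j k → height (j ℕ.+ k) ≡ height j ℚ.+ height k
    height-+ j k = trans (cong (λ n → ι (+ n)) (ℕ.*-distribʳ-+ M j k)) (ι-+ (+ (j ℕ.* M)) (+ (k ℕ.* M)))

    height-suc : ∀ k → height (suc k) ≡ ι (+ M) ℚ.+ height k
    height-suc k = ι-+ (+ M) (+ (k ℕ.* M))

    0≤height : ∀ k → 0ℚ ℚ.≤ height k
    0≤height k = ι-mono-≤ {0ℤ} {+ (k ℕ.* M)} (ℤ.+≤+ ℕ.z≤n)

    lookup-• : ∀ k i → Vec.lookup (k • w) i ≡ + (k ℕ.* M) ℤ.* b i
    lookup-• k i = begin
      Vec.lookup (k • w) i       ≡⟨ Vec.lookup-map i (λ x → + k ℤ.* x) w ⟩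
      + k ℤ.* Vec.lookup w i     ≡⟨ cong (+ k ℤ.*_) (Vec.lookup∘tabulate _ i) ⟩
      + k ℤ.* (+ M ℤ.* b i)      ≡⟨ ℤ.*-assoc (+ k) (+ M) (b i) ⟨
      (+ k ℤ.* + M) ℤ.* b i      ≡⟨ cong (ℤ._* b i) (ℤ.pos-* k M) ⟨
      + (k ℕ.* M) ℤ.* b i        ∎
      where open ≡-Reasoning

    dot-• : ∀ k → dot u (Vec.lookup (k • w)) ≡ + (k ℕ.* M)
    dot-• k = begin
      dot u (Vec.lookup (k • w))            ≡⟨ ℤΣ.sum-cong-≗ (λ i → cong (u i ℤ.*_) (lookup-• k i)) ⟩
      dot u (λ i → + (k ℕ.* M) ℤ.* b i)     ≡⟨ dot-*ʳ (+ (k ℕ.* M)) u b ⟩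
      + (k ℕ.* M) ℤ.* dot u b               ≡⟨ cong (+ (k ℕ.* M) ℤ.*_) u·b≡1 ⟩
      + (k ℕ.* M) ℤ.* 1ℤ                    ≡⟨ ℤ.*-identityʳ (+ (k ℕ.* M)) ⟩
      + (k ℕ.* M)                           ∎
      where open ≡-Reasoning

    -- Dilations grow with the number of translations, so a bound for a single one, `M + c`,
    -- suffices.
    height<dilation : ∀ q k → q ℚ.< ι (+ M) ℚ.+ c → q ℚ.< dilation (suc k)
    height<dilation q k q< = subst (q ℚ.<_)
      (trans (swap (ι (+ M)) c (height k)) (cong (ℚ._+ c) (sym (height-suc k))))
      (subst (ℚ._< (ι (+ M) ℚ.+ c) ℚ.+ height k) (ℚ.+-identityʳ q) (ℚ.+-mono-<-≤ q< (0≤height k)))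
      where
      swap : ∀ m c h → (m ℚ.+ c) ℚ.+ h ≡ (m ℚ.+ h) ℚ.+ c
      swap = solve 3 (λ m c h → (m :+ c) :+ h := (m :+ h) :+ c) refl
        where open ℚ.+-*-Solver

    b∈dilate : ∀ k σ → dilation k ℚ.* σ ≡ 1ℚ →
      embed (Vec.tabulate b) ∈ fromℚ σ · (P +ᵗ k • w)
    b∈dilate k σ Dσ≡1 = (λ i → fromℚ (c ℚ.* ι (b i)) + embed (k • w) i)
      , (_ , cb∈P , λ i → ≡⇒≈ {fromℚ (c ℚ.* ι (b i)) + embed (k • w) i}
                              {fromℚ (c ℚ.* ι (b i)) + embed (k • w) i} λ _ → refl)
      , λ i → ≡⇒≈ {fromℤ (Vec.lookup (Vec.tabulate b) i)}
                  {fromℚ σ * (fromℚ (c ℚ.* ι (b i)) + embed (k • w) i)} λ _ →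
          rescale (b i) (Vec.lookup∘tabulate b i)
            (trans (cong ι (lookup-• k i)) (ι-* (+ (k ℕ.* M)) (b i)))
      where
      open ≡-Reasoning
      regroup : ∀ s c h y → ((h ℚ.+ c) ℚ.* s) ℚ.* y ≡ s ℚ.* (c ℚ.* y ℚ.+ h ℚ.* y)
      regroup = solve 4 (λ s c h y → ((h :+ c) :* s) :* y := s :* (c :* y :+ h :* y)) refl
        where open ℚ.+-*-Solver
      rescale : ∀ y {t v} → t ≡ y → v ≡ height k ℚ.* ι y → ι t ≡ σ ℚ.* (c ℚ.* ι y ℚ.+ v)
      rescale y {v = v} refl v≡ = begin
        ι y                                       ≡⟨ ℚ.*-identityˡ (ι y) ⟨
        1ℚ ℚ.* ι y                                ≡⟨ cong (ℚ._* ι y) Dσ≡1 ⟨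
        (dilation k ℚ.* σ) ℚ.* ι y                ≡⟨ regroup σ c (height k) (ι y) ⟩
        σ ℚ.* (c ℚ.* ι y ℚ.+ height k ℚ.* ι y)    ≡⟨ cong (λ v → σ ℚ.* (c ℚ.* ι y ℚ.+ v)) v≡ ⟨
        σ ℚ.* (c ℚ.* ι y ℚ.+ v)                   ∎

    -- Such a dilate lies in the open slab 0 < u < 1.
    no-lattice-points : ∀ k D σ → 0ℚ ℚ.< D → 0ℚ ℚ.< σ → D ℚ.* σ ≡ 1ℚ →
      B ℚ.< height k → height k ℚ.+ B ℚ.< D → ∀ z → embed z ∉ fromℚ σ · (P +ᵗ k • w)
    no-lattice-points k D σ 0<D 0<σ Dσ≡1 B<h h+B<D z z∈ =
      no-integer-between (dot u (Vec.lookup z)) 0<D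
        (subst (λ t → ∣ D ℚ.* ι (dot u (Vec.lookup z)) ℚ.- ι t ∣ ℚ.≤ B) (dot-• k)
          (dot-near D (1ℚ ℚ.+ R) u (Vec.lookup z) (Vec.lookup (k • w))
            (lattice-near P D σ R bounded 0<D 0<σ Dσ≡1 z (k • w) z∈)))
        B<h h+B<D

    B<height : ∀ k → B ℚ.< height (suc k)
    B<height k = subst₂ ℚ._<_ (ℚ.+-identityʳ B) (sym (height-suc k)) (ℚ.+-mono-<-≤ B<M (0≤height k))

    -- At the inverse of `dilation k` the farther translate contains `b`, while the nearer one lies
    -- in the open slab and has no lattice point.
    distinct-from-positive : ∀ j l →
      ¬ SameEhrhart (P +ᵗ suc j • w) (P +ᵗ (suc (suc j ℕ.+ l)) • w)
    distinct-from-positive j l same =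
      let σ , 0<σ , Dσ≡1 = inverse 0<D
      in SameEhrhart⇒¬empty Pₖ Pⱼ (SameEhrhart-sym Pⱼ Pₖ same) (fromℚ σ) (fromℚ-nonNeg σ (ℚ.<⇒≤ 0<σ))
           (Vec.tabulate b) (b∈dilate k σ Dσ≡1)
           (no-lattice-points (suc j) (dilation k) σ 0<D 0<σ Dσ≡1 (B<height j) h+B<D)
      where
      k = suc (suc j ℕ.+ l)
      Pⱼ = P +ᵗ suc j • w
      Pₖ = P +ᵗ k • w
      0<D : 0ℚ ℚ.< dilation k
      0<D = height<dilation 0ℚ (suc j ℕ.+ l) 0<M+c
      gap : ∀ m c B h h′ →
        ((m ℚ.+ c) ℚ.+ h′) ℚ.- (B ℚ.+ 0ℚ) ≡ ((m ℚ.+ (h ℚ.+ h′)) ℚ.+ c) ℚ.- (h ℚ.+ B)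
      gap = solve 5 (λ m c B h h′ →
        ((m :+ c) :+ h′) :- (B :+ con 0ℚ) := ((m :+ (h :+ h′)) :+ c) :- (h :+ B)) refl
        where open ℚ.+-*-Solver
      h+B<D : height (suc j) ℚ.+ B ℚ.< dilation k
      -- Here `dilation k` splits as `M + height (suc j) + height l + c`, so that `B < M + c` is all
      -- that is required.
      h+B<D = subst (λ t → height (suc j) ℚ.+ B ℚ.< t ℚ.+ c)
        (sym (trans (height-suc (suc j ℕ.+ l)) (cong (λ t → ι (+ M) ℚ.+ t) (height-+ (suc j) l))))
        (<-from-gap (ℚ.+-mono-<-≤ B<M+c (0≤height l)) (gap (ι (+ M)) c B (height (suc j)) (height l)))

    -- With no translation the slab is centred at 0 and may contain the origin, so two dilations are
    -- compared. At `σ` the untranslated side must have a lattice point, which can only be the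
    -- origin; the origin survives halving, whereas the half dilate of the other side has no lattice
    -- point.
    distinct-from-zero : ∀ k → ¬ SameEhrhart (P +ᵗ 0 • w) (P +ᵗ suc k • w)
    distinct-from-zero k same =
      let σ , 0<σ , Dσ≡1 = inverse 0<D
          0<σ/2 = *-pos (ℚ.positive⁻¹ ½) 0<σ
      in SameEhrhart⇒¬empty Pₖ P₀ (SameEhrhart-sym P₀ Pₖ same) (fromℚ σ) (fromℚ-nonNeg σ (ℚ.<⇒≤ 0<σ))
           (Vec.tabulate b) (b∈dilate (suc k) σ Dσ≡1) λ z z∈ →
             SameEhrhart⇒¬empty P₀ Pₖ same (fromℚ (½ ℚ.* σ)) (fromℚ-nonNeg (½ ℚ.* σ) (ℚ.<⇒≤ 0<σ/2)) z
               (halve-origin P₀ σ z (origin z (lattice-near P D σ R bounded 0<D 0<σ Dσ≡1 z (0 • w) z∈)) z∈)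
               -- The inverse of `½ σ` is `D + D`, so the upper slab condition is
               -- `height (suc k) + B < 2 D`, which follows from `B < M + 2 c`.
               (no-lattice-points (suc k) (D ℚ.+ D) (½ ℚ.* σ) (ℚ.+-mono-< 0<D 0<D) 0<σ/2
                 (trans (double D σ) Dσ≡1) (B<height k) h+B<2D)
      where
      P₀ = P +ᵗ 0 • w
      Pₖ = P +ᵗ suc k • w
      D = dilation (suc k)
      0<D : 0ℚ ℚ.< D
      0<D = height<dilation 0ℚ k 0<M+c
      open ℚ.+-*-Solver
      double : ∀ D σ → (D ℚ.+ D) ℚ.* (½ ℚ.* σ) ≡ D ℚ.* σ
      double = solve 2 (λ D σ → (D :+ D) :* (con ½ :* σ) := D :* σ) refl
      origin : ∀ z → (∀ i → ∣ D ℚ.* ι (Vec.lookup z i) ℚ.- ι (Vec.lookup (0 • w) i) ∣ ℚ.≤ 1ℚ ℚ.+ R) →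
        ∀ i → Vec.lookup z i ≡ 0ℤ
      origin z near i = small-integer (Vec.lookup z i) 0<D
        (subst (λ q → ∣ q ∣ ℚ.≤ 1ℚ ℚ.+ R)
          (trans (cong (λ t → D ℚ.* ι (Vec.lookup z i) ℚ.- ι t) (lookup-• 0 i)) (ℚ.+-identityʳ _))
          (near i))
        (height<dilation (1ℚ ℚ.+ R) k 1+R<M+c)
      gap : ∀ m c B h →
        ((m ℚ.+ (c ℚ.+ c)) ℚ.+ h) ℚ.- (B ℚ.+ 0ℚ) ≡
        (((m ℚ.+ h) ℚ.+ c) ℚ.+ ((m ℚ.+ h) ℚ.+ c)) ℚ.- ((m ℚ.+ h) ℚ.+ B)
      gap = solve 4 (λ m c B h →
        ((m :+ (c :+ c)) :+ h) :- (B :+ con 0ℚ) :=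
        (((m :+ h) :+ c) :+ ((m :+ h) :+ c)) :- ((m :+ h) :+ B)) refl
      h+B<2D : height (suc k) ℚ.+ B ℚ.< D ℚ.+ D
      h+B<2D = subst (λ t → t ℚ.+ B ℚ.< (t ℚ.+ c) ℚ.+ (t ℚ.+ c)) (sym (height-suc k))
        (<-from-gap (ℚ.+-mono-<-≤ B<M+2c (0≤height k)) (gap (ι (+ M)) c B (height k)))

    distinct-< : ∀ j k → j ℕ.< k → ¬ SameEhrhart (P +ᵗ j • w) (P +ᵗ k • w)
    distinct-< zero    (suc k) _   = distinct-from-zero k
    distinct-< (suc j) k       j<k with ℕ.m≤n⇒∃[o]m+o≡n j<k
    ... | l , refl = distinct-from-positive j l

    distinct : ∀ j k → j ≢ k → ¬ SameEhrhart (P +ᵗ j • w) (P +ᵗ k • w)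
    distinct j k j≢k same with ℕ.<-cmp j k
    ... | tri< j<k _ _ = distinct-< j k j<k same
    ... | tri≈ _ j≡k _ = j≢k j≡k
    ... | tri> _ _ k<j = distinct-< k j k<j (SameEhrhart-sym (P +ᵗ j • w) (P +ᵗ k • w) same)

  separating-translation : ∃ λ (w : Vec ℤ d) → ∀ (j k : ℕ) → j ≢ k →
    ¬ SameEhrhart (P +ᵗ j • w) (P +ᵗ k • w)
  separating-translation =
    let M , bound = archimedean-all {5}
          -- The thresholds follow the order of the parameters of `Scaled`, with the multiples of
          -- `c` moved to the left; `above` moves them back.
          ((1ℚ ℚ.+ R) ℚ.- c ◂ B ◂ B ℚ.- c ◂ B ℚ.- (c ℚ.+ c) ◂ 0ℚ ℚ.- c ◂ λ ())
        above : ∀ {q r} → q ℚ.- r ℚ.< ι (+ M) → q ℚ.< ι (+ M) ℚ.+ r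
        above {q} {r} q-r<M = <-from-gap q-r<M (gap (ι (+ M)) q r)
        open Scaled M (above (bound zero)) (bound (suc zero)) (above (bound (suc (suc zero))))
          (above (bound (suc (suc (suc zero))))) (above (bound (suc (suc (suc (suc zero))))))
    in w , distinct
    where
    gap : ∀ m q r → m ℚ.- (q ℚ.- r) ≡ (m ℚ.+ r) ℚ.- q
    gap = solve 3 (λ m q r → m :- (q :- r) := (m :+ r) :- q) refl
      where open ℚ.+-*-Solver

theorem1 : ∀ (d : ℕ) .{{_ : NonZero d}} (P : Subset d) →
    IsRationalPolytope P → Satisfiable P →
    ∃ λ (w : Vec ℤ d) → ∀ (j k : ℕ) → j ≢ k →
    ¬ SameEhrhart (P +ᵗ j • w) (P +ᵗ k • w)
theorem1 (suc d) P (zero , v , P⊆hull , _) (x , x∈P) =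
  -- An empty family has coefficient sum 0, which would have to equal 1.
  let _ , _ , 0≈1 , _ = P⊆hull x∈P
      N , 1<1 = 0≈1 1ℚ (ℚ.positive⁻¹ 1ℚ)
  in contradiction (1<1 N ℕ.≤-refl) (ℚ.<-irrefl refl)
theorem1 (suc d) P (suc m , v , P⊆hull , hull⊆P) _ =
  -- The first listed point plays the part of the vertex: the argument uses only that it is a
  -- rational point of `P`.
  let c , b , u , v₀≡cb , u·b≡1 = primitiveVector (v zero)
      R , bounded = convexHull-bounded v
  in Translates.separating-translation (λ {x} x∈P → bounded {x} (P⊆hull x∈P)) c b u
       (hull⊆P (vertex∈convexHull v λ i → sym (v₀≡cb i))) u·b≡1
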